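{- Let $n\geq 1$, let $A\subseteq \mathbb{Z}^n$, and suppose $\dim \mathrm{Nb}(A)=d$ for some $d\in\mathbb{N}$. Then $\mathrm{Nb}(A)$ is locally finite; equivalently, every $a\in A$ has only finitely many $A$-neighbors.
   Context: For $a,b\in\mathbb{R}^n$, write $a \ll b$ if $\pi_i(a)<\pi_i(b)$ for all $i=1,\dots,n$, where $\pi_i$ is the $i$-th coordinate. For $B\subseteq\mathbb{R}^n$, $\vee B$ denotes the coordinatewise supremum in $(\mathbb{R}\cup\{\pm\infty\})^n$, i.e. $\pi_i(\vee B)=\sup\{\pi_i(b)\mid b\in B\}$. For $A\subseteq\mathbb{R}^n$, the neighbor complex $\mathrm{Nb}(A)$ is the set of all subsets $B\subseteq A$ such that there is no $a\in A$ with $a\ll \vee B$; it is an abstract simplicial complex on the vertex set $A$. Two points $a,a'\in A$ are called $A$-neighbors if $\{a,a'\}\in\mathrm{Nb}(A)$. For $B\in\mathrm{Nb}(A)$, $\dim B:=\mathrm{card}(B)-1$. We say $\dim\mathrm{Nb}(A)=d$ if $\dim B\leq d$ for all $B\in\mathrm{Nb}(A)$ and $\dim B=d$ for at least one $B\in\mathrm{Nb}(A)$. A simplicial complex is locally finite if each vertex is contained in only finitely many simplices. -}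

module Defs where

open import Data.Fin.Base using (Fin)
open import Data.Integer.Base as ℤ using (ℤ; +_; _-_)
open import Data.List.Base using (length)
open import Data.List.Membership.Propositional using () renaming (_∈_ to _∈ₗ_)
open import Data.List.Relation.Unary.All using (All)
open import Data.List.Relation.Unary.Any using (Any)
open import Data.List.Relation.Unary.Unique.Propositional using (Unique)
open import Data.Nat.Base using (ℕ)
open import Data.Product.Base using (∃; _×_)
open import Data.Vec.Base using (Vec; lookup)
open import Function.Bundles using (_⇔_)
open import Level using (0ℓ)
open import Relation.Binary.Core using (Rel)
open import Relation.Binary.Construct.Add.Extrema.NonStrict ℤ._≤_ using (_≤±_)
open import Relation.Binary.Construct.Add.Extrema.Strict ℤ._<_ using (_<±_)
open import Relation.Binary.PropositionalEquality.Core using (_≡_)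
open import Relation.Nullary.Construct.Add.Extrema using (_±; [_])
open import Relation.Nullary.Negation.Core using (¬_)
open import Relation.Unary using (Pred; _∈_; _⊆_; _≐_; _∪_; ｛_｝)

Point : ℕ → Set
Point n = Vec ℤ n

Subset : ℕ → Set₁
Subset n = Pred (Point n) 0ℓ

-- ℤ ± is ℤ ∪ {±∞}.  A set of integers has the same supremum there as in
-- ℝ ∪ {±∞}: the maximum, or −∞ for the empty set, or +∞ if unbounded above.

IsSupremum : Pred (ℤ ±) 0ℓ → ℤ ± → Set
IsSupremum S s = (∀ x → x ∈ S → x ≤± s)
               × (∀ u → (∀ x → x ∈ S → x ≤± u) → s ≤± u)

π[_] : ∀ {n} → Fin n → Subset n → Pred (ℤ ±) 0ℓ
π[ i ] B x = ∃ λ b → b ∈ B × x ≡ [ lookup b i ]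

-- s = ∨ B.  The join is a relation because the existence of suprema of
-- arbitrary sets of integers needs excluded middle; it is always unique.

IsJoin : ∀ {n} → Subset n → Vec (ℤ ±) n → Set
IsJoin B s = ∀ i → IsSupremum (π[ i ] B) (lookup s i)

infix 4 _≪_ _≪∨_

_≪_ : ∀ {n} → Point n → Vec (ℤ ±) n → Set
a ≪ s = ∀ i → [ lookup a i ] <± lookup s i

_≪∨_ : ∀ {n} → Point n → Subset n → Set
a ≪∨ B = ∃ λ s → IsJoin B s × a ≪ s

Nb : ∀ {n} → Subset n → Pred (Subset n) 0ℓ
Nb A B = B ⊆ A × ¬ (∃ λ a → a ∈ A × a ≪∨ B)

Neighbors : ∀ {n} → Subset n → Point n → Point n → Set
Neighbors A a a′ = a ∈ A × a′ ∈ A × (｛ a ｝ ∪ ｛ a′ ｝) ∈ Nb A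

HasCard : ∀ {n} → Subset n → ℕ → Set
HasCard B k = ∃ λ xs → Unique xs × (∀ x → x ∈ B ⇔ x ∈ₗ xs) × length xs ≡ k

-- Integer-valued, since the empty simplex has dimension −1.  Infinite sets
-- have no dimension, hence satisfy HasDim≤ for no bound.

HasDim : ∀ {n} → Subset n → ℤ → Set
HasDim B e = ∃ λ k → HasCard B k × e ≡ + k - + 1

HasDim≤ : ∀ {n} → Subset n → ℤ → Set
HasDim≤ B d = ∃ λ e → HasDim B e × e ℤ.≤ d

ComplexHasDim : ∀ {n} → Pred (Subset n) 0ℓ → ℤ → Set₁
ComplexHasDim K d = (∀ B → B ∈ K → HasDim≤ B d)
                  × (∃ λ B → B ∈ K × HasDim B d)

FinitelyMany : ∀ {a} {X : Set a} → Rel X 0ℓ → Pred X 0ℓ → Set a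
FinitelyMany _≈_ P = ∃ λ xs → All P xs × (∀ x → x ∈ P → Any (x ≈_) xs)

-- Subsets are counted up to having the same elements.

LocallyFinite : ∀ {n} → Subset n → Pred (Subset n) 0ℓ → Set₁
LocallyFinite V K = ∀ v → v ∈ V → FinitelyMany _≐_ (λ B → B ∈ K × v ∈ B)

{-# OPTIONS --safe #-}
-- If a vertex v had infinitely many neighbors, then some infinite set S of
-- them would be such that each truncated coordinate x ↦ v_i ⊔ x_i is constant
-- on S or tends to infinity along S.  A point a ≪ ∨({v} ∪ S) then satisfies
-- a ≪ v ∨ x for all but finitely many x ∈ S, which is impossible as x is a
-- neighbor of v.  So {v} ∪ S would be an infinite simplex.
module Submission where

open import Defs
open import Axiom.ExcludedMiddle using (ExcludedMiddle)
open import Data.Integer.Base using (+_)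
open import Data.Nat.Base using (ℕ; _≥_)
open import Data.Product.Base using (_×_)
open import Level using (0ℓ)
open import Relation.Binary.PropositionalEquality.Core using (_≡_)
open import Relation.Unary using (_∈_)

open import Algebra.Properties.CommutativeSemigroup using (x∙yz≈y∙xz)
open import Data.Fin.Base using (Fin; zero; suc)
open import Data.Integer.Base as ℤ using (ℤ; -[1+_]; ∣_∣; _⊔_; -≤+; +<+)
import Data.Integer.Properties as ℤ
open import Data.Integer.Tactic.RingSolver using (solve-∀)
open import Data.List.Base using (List; []; _∷_; _++_; map; filter; concat; tabulate)
open import Data.List.Extrema ℤ.≤-totalOrder using (argmax; argmax-all; f[xs]≤f[argmax])
open import Data.List.Membership.Propositional using (lose) renaming (_∈_ to _∈ₗ_)
open import Data.List.Membership.Propositional.Properties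
  using (∈-++⁺ˡ; ∈-++⁺ʳ; ∈-map⁺; ∈-concat⁺′; ∈-tabulate⁺; ∈-filter⁺; ∈-filter⁻)
import Data.List.Relation.Unary.All as All
open import Data.List.Relation.Unary.All.Properties using (all-filter)
open import Data.List.Relation.Unary.Any as Any using (Any; here; there)
import Data.List.Relation.Unary.Any.Properties as Any
import Data.Nat.Properties as ℕ
open import Data.Product.Base using (∃; _,_; proj₁; proj₂)
open import Data.Sum.Base using (_⊎_; inj₁; inj₂; [_,_]′)
open import Data.Vec.Base as Vec using (lookup)
open import Data.Vec.Properties using (lookup∘tabulate)
open import Function.Base using (_∘_; id)
open import Function.Bundles using (module Equivalence)
open import Relation.Binary.Construct.Add.Extrema.NonStrict ℤ._≤_ using ([_])
import Relation.Binary.Construct.Add.Extrema.Strict ℤ._<_ as Strict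
open import Relation.Binary.Core using (Rel)
open import Relation.Binary.Definitions using (_Respects_)
open import Relation.Binary.PropositionalEquality.Core
  using (refl; sym; trans; cong; subst)
open import Relation.Nullary.Construct.Add.Extrema using (_±) renaming ([_] to [_]±)
open import Relation.Nullary.Decidable.Core using (yes; no; decidable-stable)
open import Relation.Nullary.Negation.Core using (¬_; contradiction)
open import Relation.Unary using (Pred; Decidable; _⊆_; _≐_; _∩_; _∪_; ｛_｝)

-- Finiteness

-- The list may also contain elements outside `P`, so finiteness passes to subsets with the same
-- list.
Covered : ∀ {X : Set} → Pred X 0ℓ → Set
Covered P = ∃ λ xs → P ⊆ (_∈ₗ xs)

module _ {X : Set} where

  covered-⊆ : {P Q : Pred X 0ℓ} → P ⊆ Q → Covered Q → Covered P
  covered-⊆ P⊆Q (xs , Q⊆xs) = xs , Q⊆xs ∘ P⊆Q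

  covered-∪ : {P Q : Pred X 0ℓ} → Covered P → Covered Q → Covered (P ∪ Q)
  covered-∪ (xs , P⊆xs) (ys , Q⊆ys) =
    xs ++ ys , [ ∈-++⁺ˡ ∘ P⊆xs , ∈-++⁺ʳ xs ∘ Q⊆ys ]′

  covered-⋃ : ∀ {n} {P : Fin n → Pred X 0ℓ} →
              (∀ i → Covered (P i)) → Covered (λ x → ∃ λ i → x ∈ P i)
  covered-⋃ cov =
    concat (tabulate (proj₁ ∘ cov)) ,
    λ (i , Px) → ∈-concat⁺′ (proj₂ (cov i) Px) (∈-tabulate⁺ i)

-- `FinitelyMany` admits only entries satisfying `P`, so the others are filtered out. An entry that
-- represents some `x ∈ P` survives because `P` respects `_≈_`.
finitelyMany-filter : ∀ {a} {X : Set a} {_≈_ : Rel X 0ℓ} {P : Pred X 0ℓ} →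
                      Decidable P → P Respects _≈_ →
                      ∀ xs → (∀ x → x ∈ P → Any (x ≈_) xs) → FinitelyMany _≈_ P
finitelyMany-filter {_≈_ = _≈_} {P} P? resp xs cover =
  filter P? xs , all-filter P? xs , kept
  where
  kept : ∀ x → x ∈ P → Any (x ≈_) (filter P? xs)
  kept x Px with Any.filter⁺ P? (cover x Px)
  ... | inj₁ x∈   = x∈
  ... | inj₂ ¬Py = contradiction (resp (Any.lookup-result (cover x Px)) Px) ¬Py

powerset : ∀ {X : Set} → List X → List (List X)
powerset []       = [] ∷ []
powerset (x ∷ xs) = powerset xs ++ map (x ∷_) (powerset xs)

filter∈powerset : ∀ {X : Set} {P : Pred X 0ℓ} (P? : Decidable P) xs →
                  filter P? xs ∈ₗ powerset xs
filter∈powerset P? []       = here refl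
filter∈powerset P? (x ∷ xs) with P? x
... | yes _ = ∈-++⁺ʳ (powerset xs) (∈-map⁺ (x ∷_) (filter∈powerset P? xs))
... | no  _ = ∈-++⁺ˡ (filter∈powerset P? xs)

-- The sublist representing `P` is `filter P? xs`.
⊆⇒∈powerset : ∀ {X : Set} {P : Pred X 0ℓ} → Decidable P → ∀ {xs} → P ⊆ (_∈ₗ xs) →
              Any (P ≐_) (map (λ ys → _∈ₗ ys) (powerset xs))
⊆⇒∈powerset P? {xs} P⊆xs = Any.map⁺ (lose (filter∈powerset P? xs)
  ((λ Px → ∈-filter⁺ P? (P⊆xs Px) Px) , (λ x∈ → proj₂ (∈-filter⁻ P? {xs = xs} x∈))))

-- Infinite subsets along which integer-valued functions are monotone

m<l+suc∣m-l∣ : ∀ l m → m ℤ.< l ℤ.+ + (ℕ.suc ∣ m ℤ.- l ∣)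
m<l+suc∣m-l∣ l m = subst (ℤ._< l ℤ.+ + (ℕ.suc ∣ m ℤ.- l ∣)) (sym (split l m))
  (ℤ.+-monoʳ-< l (ℤ.≤-<-trans (i≤∣i∣ (m ℤ.- l)) (+<+ (ℕ.n<1+n _))))
  where
  split : ∀ l m → m ≡ l ℤ.+ (m ℤ.- l)
  split = solve-∀
  i≤∣i∣ : ∀ i → i ℤ.≤ + ∣ i ∣
  i≤∣i∣ (+ n)    = ℤ.≤-refl
  i≤∣i∣ -[1+ n ] = -≤+

<+suc⇒<+⊎≡+ : ∀ {i} l k → i ℤ.< l ℤ.+ + ℕ.suc k → i ℤ.< l ℤ.+ + k ⊎ i ≡ l ℤ.+ + k
<+suc⇒<+⊎≡+ {i} l k i<l+1+k with i ℤ.<? l ℤ.+ + k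
... | yes i<l+k = inj₁ i<l+k
... | no  i≮l+k = inj₂ (ℤ.≤∧≮⇒≡ i≤l+k i≮l+k)
  where
  i≤l+k : i ℤ.≤ l ℤ.+ + k
  i≤l+k = subst (i ℤ.≤_)
    (trans (cong ℤ.pred (x∙yz≈y∙xz ℤ.+-commutativeSemigroup l (+ 1) (+ k)))
           (ℤ.pred-suc (l ℤ.+ + k)))
    (ℤ.i<j⇒i≤pred[j] i<l+1+k)

-- The common consequence of "f is constant on S" and "f tends to infinity
-- along S" that the argument needs.
Steady : ∀ {X : Set} → (X → ℤ) → Pred X 0ℓ → Set
Steady f S = ∀ m → Covered (S ∩ λ x → f x ℤ.≤ m) ⊎ (∀ {x} → x ∈ S → f x ℤ.≤ m)

steady-⊆ : ∀ {X : Set} {f : X → ℤ} {S T : Pred X 0ℓ} → S ⊆ T → Steady f T → Steady f S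
steady-⊆ S⊆T steady m with steady m
... | inj₁ cov = inj₁ (covered-⊆ (λ (Sx , fx≤m) → S⊆T Sx , fx≤m) cov)
... | inj₂ all = inj₂ (all ∘ S⊆T)

module _ (em : ExcludedMiddle 0ℓ) where

  -- If some fibre of `f` in `P` is infinite, that fibre serves, as `f` is constant on it. Otherwise
  -- `P` itself serves: since `f` is bounded below, each sublevel set is a finite union of finite
  -- fibres.
  steadySubset : ∀ {X : Set} (f : X → ℤ) l → (∀ x → l ℤ.≤ f x) →
                 ∀ {P : Pred X 0ℓ} → ¬ Covered P →
                 ∃ λ S → S ⊆ P × ¬ Covered S × Steady f S
  steadySubset f l l≤f {P} infinite
    with em {∃ λ c → ¬ Covered (P ∩ λ x → f x ≡ c)}
  ... | yes (c , infiniteFibre) = _ , proj₁ , infiniteFibre , steady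
    where
    steady : Steady f (P ∩ λ x → f x ≡ c)
    steady m with c ℤ.≤? m
    ... | yes c≤m = inj₂ λ (_ , fx≡c) → subst (ℤ._≤ m) (sym fx≡c) c≤m
    ... | no  c≰m = inj₁ ([] , λ ((_ , fx≡c) , fx≤m) →
                            contradiction (subst (ℤ._≤ m) fx≡c fx≤m) c≰m)
  ... | no noInfiniteFibre = P , id , infinite , λ m →
    inj₁ (covered-⊆ (λ (Px , fx≤m) → Px , ℤ.≤-<-trans fx≤m (m<l+suc∣m-l∣ l m))
                    (below (ℕ.suc ∣ m ℤ.- l ∣)))
    where
    fibre : ∀ c → Covered (P ∩ λ x → f x ≡ c)
    fibre c = decidable-stable em (λ infiniteFibre → noInfiniteFibre (c , infiniteFibre))

    -- Each step adds the fibre over one more integer, starting from the empty set of values below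
    -- `l`.
    below : ∀ k → Covered (P ∩ λ x → f x ℤ.< l ℤ.+ + k)
    below ℕ.zero    = [] , λ {x} (_ , fx<l+0) →
      contradiction (l≤f x) (ℤ.<⇒≱ (subst (f x ℤ.<_) (ℤ.+-identityʳ l) fx<l+0))
    below (ℕ.suc k) = covered-⊆
      (λ (Px , fx<) → [ inj₁ ∘ (Px ,_) , inj₂ ∘ (Px ,_) ]′ (<+suc⇒<+⊎≡+ l k fx<))
      (covered-∪ (below k) (fibre (l ℤ.+ + k)))

  -- Steadiness is inherited by subsets, so the functions can be treated one after another, each
  -- time thinning out the set already found.
  simultaneouslySteadySubset :
    ∀ {X : Set} n (f : Fin n → X → ℤ) (l : Fin n → ℤ) → (∀ i x → l i ℤ.≤ f i x) →
    ∀ {P : Pred X 0ℓ} → ¬ Covered P →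
    ∃ λ S → S ⊆ P × ¬ Covered S × (∀ i → Steady (f i) S)
  simultaneouslySteadySubset ℕ.zero f l l≤f infinite = _ , id , infinite , λ ()
  simultaneouslySteadySubset (ℕ.suc n) f l l≤f infinite
    with T , T⊆P , infiniteT , steadyT ←
           simultaneouslySteadySubset n (f ∘ suc) (l ∘ suc) (l≤f ∘ suc) infinite
    with S , S⊆T , infiniteS , steadyS ← steadySubset (f zero) (l zero) (l≤f zero) infiniteT
    = S , T⊆P ∘ S⊆T , infiniteS , λ where
        zero    → steadyS
        (suc i) → steady-⊆ S⊆T (steadyT i)

-- Joins and the neighbor complex

infix 4 _⋘_

-- a ≪ ∨ B without reference to the supremum.
_⋘_ : ∀ {n} → Point n → Subset n → Set
a ⋘ B = ∀ i → ∃ λ b → b ∈ B × lookup a i ℤ.< lookup b i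

⋘-⊆ : ∀ {n} (a : Point n) {B C : Subset n} → B ⊆ C → a ⋘ B → a ⋘ C
⋘-⊆ _ B⊆C a⋘B i with b , b∈B , a<b ← a⋘B i = b , B⊆C b∈B , a<b

maximum⇒supremum : ∀ {n} {B : Subset n} i {b} → b ∈ B →
                   (∀ {x} → x ∈ B → lookup x i ℤ.≤ lookup b i) →
                   IsSupremum (π[ i ] B) [ lookup b i ]±
maximum⇒supremum i b∈B max =
  (λ { _ (x , x∈B , refl) → [ max x∈B ] }) , λ u bound → bound _ (_ , b∈B , refl)

-- As `B` is finite, its supremum in each coordinate is attained.
⋘⇒≪∨ : ∀ {n} (a : Point n) {B : Subset n} {xs} → B ≐ (_∈ₗ xs) → a ⋘ B → a ≪∨ B
⋘⇒≪∨ {n} a {B} {xs} (B⊆xs , xs⊆B) a⋘B =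
  Vec.tabulate sup ,
  (λ i → subst (IsSupremum (π[ i ] B)) (sym (lookup∘tabulate sup i)) (isSup i)) ,
  (λ i → subst ([ lookup a i ]± Strict.<±_) (sym (lookup∘tabulate sup i)) (a<sup i))
  where
  -- The default of `argmax` is the witness from `a⋘B i`, which lies in `B`, so the maximum is
  -- always taken at a point of `B`.
  top : Fin n → Point n
  top i = argmax (λ x → lookup x i) (proj₁ (a⋘B i)) xs

  sup : Fin n → ℤ ±
  sup i = [ lookup (top i) i ]±

  top-max : ∀ i {x} → x ∈ B → lookup x i ℤ.≤ lookup (top i) i
  top-max i x∈B = All.lookup (f[xs]≤f[argmax] {f = λ x → lookup x i} (proj₁ (a⋘B i)) xs) (B⊆xs x∈B)

  isSup : ∀ i → IsSupremum (π[ i ] B) (sup i)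
  isSup i = maximum⇒supremum i
    (argmax-all (λ x → lookup x i) {P = B} (proj₁ (proj₂ (a⋘B i))) (All.tabulate xs⊆B)) (top-max i)

  a<sup : ∀ i → [ lookup a i ]± Strict.<± sup i
  a<sup i = let b , b∈B , a<b = a⋘B i in Strict.[ ℤ.<-≤-trans a<b (top-max i b∈B) ]

Nb⇒¬⋘ : ∀ {n} {A B : Subset n} {xs} → B ≐ (_∈ₗ xs) → B ∈ Nb A →
        ∀ a → a ∈ A → ¬ (a ⋘ B)
Nb⇒¬⋘ B≐xs (_ , no-≪) a a∈A a⋘B = no-≪ (a , a∈A , ⋘⇒≪∨ a B≐xs a⋘B)

pair≐list : ∀ {X : Set} (x y : X) → (｛ x ｝ ∪ ｛ y ｝) ≐ (_∈ₗ (x ∷ y ∷ []))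
pair≐list x y =
  (λ { (inj₁ refl) → here refl ; (inj₂ refl) → there (here refl) }) ,
  (λ { (here refl) → inj₁ refl ; (there (here refl)) → inj₂ refl })

hasDim≤⇒finite : ∀ {n} {B : Subset n} {d} → HasDim≤ B d → ∃ λ xs → B ≐ (_∈ₗ xs)
hasDim≤⇒finite (_ , (_ , (xs , _ , B⇔xs , _) , _) , _) =
  xs , Equivalence.to (B⇔xs _) , Equivalence.from (B⇔xs _)

module _ (em : ExcludedMiddle 0ℓ) where

  -- If no point of `B` exceeded `a` in coordinate `i`, then that coordinate of `a` would be an
  -- upper bound, hence at least the supremum. `B` may be infinite here.
  ≪∨⇒⋘ : ∀ {n} (a : Point n) {B : Subset n} → a ≪∨ B → a ⋘ B
  ≪∨⇒⋘ a {B} (s , isJoin , a≪s) i = decidable-stable em λ none →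
    Strict.<±-irrefl-≡ ℤ.<-irrefl refl
      (Strict.<±-transˡ ℤ.<-≤-trans (a≪s i)
        (proj₂ (isJoin i) [ lookup a i ]± λ { _ (b , b∈B , refl) →
          [ ℤ.≮⇒≥ (λ a<b → none (b , b∈B , a<b)) ] }))

  ¬⋘⇒Nb : ∀ {n} {A B : Subset n} → B ⊆ A → (∀ a → a ∈ A → ¬ (a ⋘ B)) → B ∈ Nb A
  ¬⋘⇒Nb B⊆A ¬⋘ = B⊆A , λ (a , a∈A , a≪∨B) → ¬⋘ a a∈A (≪∨⇒⋘ a a≪∨B)

  neighbors-covered : ∀ {n} {A : Subset n} {d v} → (∀ B → B ∈ Nb A → HasDim≤ B d) →
                      v ∈ A → Covered (Neighbors A v)
  neighbors-covered {n} {A} {d} {v} bounded v∈A = decidable-stable em infinite⇒⊥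
    where
    -- Coordinate `i` of the join of `v` and `x`. Truncating at `v` supplies the lower bound needed
    -- to extract steady subsets.
    height : Fin n → Point n → ℤ
    height i x = lookup v i ⊔ lookup x i

    infinite⇒⊥ : ¬ ¬ Covered (Neighbors A v)
    infinite⇒⊥ infinite
      with S , S⊆N , infiniteS , steady ←
             simultaneouslySteadySubset em n height (lookup v)
               (λ i x → ℤ.i≤i⊔j (lookup v i) (lookup x i)) infinite
      = infiniteS (covered-⊆ inj₂ B-covered)
      where
      B : Subset n
      B = ｛ v ｝ ∪ S

      B⊆A : B ⊆ A
      B⊆A (inj₁ refl) = v∈A
      B⊆A (inj₂ x∈S)  = proj₁ (proj₂ (S⊆N x∈S))

      -- If `v` exceeds `a` in coordinate `i`, then so does every height, and the set is empty. If
      -- some `b ∈ S` does, its height rules out the second alternative of `Steady`.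
      low-covered : ∀ a → a ⋘ B → ∀ i → Covered (S ∩ λ x → height i x ℤ.≤ lookup a i)
      low-covered a a⋘B i with a⋘B i
      ... | _ , inj₁ refl , a<v = [] , λ (_ , h≤a) →
              contradiction (ℤ.≤-trans (ℤ.i≤i⊔j (lookup v i) _) h≤a) (ℤ.<⇒≱ a<v)
      ... | b , inj₂ b∈S , a<b with steady i (lookup a i)
      ...   | inj₁ cov = cov
      ...   | inj₂ all = contradiction
              (ℤ.≤-trans (ℤ.i≤j⊔i (lookup v i) (lookup b i)) (all b∈S)) (ℤ.<⇒≱ a<b)

      high⇒⋘ : ∀ a x → ¬ (∃ λ i → height i x ℤ.≤ lookup a i) → a ⋘ (｛ v ｝ ∪ ｛ x ｝)
      high⇒⋘ a x ¬low i with ℤ.⊔-sel (lookup v i) (lookup x i)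
      ... | inj₁ h≡v = v , inj₁ refl , subst (_ ℤ.<_) h≡v (ℤ.≰⇒> λ h≤a → ¬low (i , h≤a))
      ... | inj₂ h≡x = x , inj₂ refl , subst (_ ℤ.<_) h≡x (ℤ.≰⇒> λ h≤a → ¬low (i , h≤a))

      B∈Nb : B ∈ Nb A
      B∈Nb = ¬⋘⇒Nb B⊆A λ a a∈A a⋘B →
        -- Each `x ∈ S` is low in some coordinate, as otherwise `a ⋘ ｛ v ｝ ∪ ｛ x ｝` although `x` is
        -- a neighbor of `v`. So finitely many finite sets cover `S`.
        infiniteS (covered-⊆
          (λ {x} x∈S → decidable-stable em λ ¬low →
            Nb⇒¬⋘ (pair≐list v x) (proj₂ (proj₂ (S⊆N x∈S))) a a∈A
              (high⇒⋘ a x λ (i , h≤a) → ¬low (i , x∈S , h≤a)))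
          (covered-⋃ (low-covered a a⋘B)))

      B-covered : Covered B
      B-covered = let xs , B⊆xs , _ = hasDim≤⇒finite (bounded B B∈Nb) in xs , B⊆xs

  -- Pairs in a simplex are its faces, and `_⋘_` is monotone in the set. The dimension bound makes
  -- `B` finite, so that its join exists where `Nb⇒¬⋘` needs it.
  simplex⊆neighbors : ∀ {n} {A B : Subset n} {d v} → HasDim≤ B d → B ∈ Nb A → v ∈ B →
                      B ⊆ Neighbors A v
  simplex⊆neighbors {A = A} {B} {v = v} B-dim B∈Nb@(B⊆A , _) v∈B {x} x∈B =
    B⊆A v∈B , B⊆A x∈B ,
    ¬⋘⇒Nb (B⊆A ∘ pair⊆B) λ a a∈A a⋘pair →
      Nb⇒¬⋘ (proj₂ (hasDim≤⇒finite B-dim)) B∈Nb a a∈A (⋘-⊆ a pair⊆B a⋘pair)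
    where
    pair⊆B : (｛ v ｝ ∪ ｛ x ｝) ⊆ B
    pair⊆B (inj₁ refl) = v∈B
    pair⊆B (inj₂ refl) = x∈B

  Nb-respects-≐ : ∀ {n} {A B C : Subset n} {d} → HasDim≤ B d → B ≐ C → B ∈ Nb A → C ∈ Nb A
  Nb-respects-≐ B-dim (B⊆C , C⊆B) B∈Nb =
    ¬⋘⇒Nb (proj₁ B∈Nb ∘ C⊆B) λ a a∈A a⋘C →
      Nb⇒¬⋘ (proj₂ (hasDim≤⇒finite B-dim)) B∈Nb a a∈A (⋘-⊆ a C⊆B a⋘C)

mainTheorem1 : ExcludedMiddle 0ℓ →
    (n : ℕ) → n ≥ 1 → (A : Subset n) → (d : ℕ) → ComplexHasDim (Nb A) (+ d) →
    LocallyFinite A (Nb A) × (∀ a → a ∈ A → FinitelyMany _≡_ (Neighbors A a))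
mainTheorem1 em n _ A d (bounded , _) = locallyFinite , finitelyManyNeighbors
  where
  finitelyManyNeighbors : ∀ a → a ∈ A → FinitelyMany _≡_ (Neighbors A a)
  finitelyManyNeighbors a a∈A =
    let xs , N⊆xs = neighbors-covered em bounded a∈A in
    finitelyMany-filter {P = Neighbors A a} (λ _ → em) (subst (Neighbors A a)) xs (λ _ → N⊆xs)

  locallyFinite : LocallyFinite A (Nb A)
  locallyFinite v v∈A =
    let xs , N⊆xs = neighbors-covered em bounded v∈A in
    finitelyMany-filter {_≈_ = _≐_} {P = λ B → B ∈ Nb A × v ∈ B} (λ _ → em)
      (λ B≐C (B∈Nb , v∈B) → Nb-respects-≐ em (bounded _ B∈Nb) B≐C B∈Nb , proj₁ B≐C v∈B)
      -- A simplex containing `v` consists of neighbors of `v`, so the sublists of a list covering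
      -- these represent all candidates.
      (map (λ ys → _∈ₗ ys) (powerset xs))
      (λ B (B∈Nb , v∈B) → ⊆⇒∈powerset (λ _ → em)
        (N⊆xs ∘ simplex⊆neighbors em (bounded B B∈Nb) B∈Nb v∈B))
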